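{- For every integer $k\ge 14$, $r_k(k+1,k+1)>\left(\operatorname{twr}_{\lfloor k/2\rfloor-4}(2)\right)^2$.
   Context: The Ramsey number $r_k(s,m)$ is the smallest integer $N$ such that every red/blue coloring of the $k$-element subsets of $[N]=\{1,\dots,N\}$ contains either an $s$-element subset of $[N]$ all of whose $k$-subsets are red or an $m$-element subset of $[N]$ all of whose $k$-subsets are blue. The tower function is defined by $\operatorname{twr}_1(x)=x$ and $\operatorname{twr}_{i+1}(x)=2^{\operatorname{twr}_i(x)}$. -}

module Defs where

open import Data.Fin.Subset using (Subset; ∣_∣; _⊆_)
open import Data.Nat using (ℕ; zero; suc; _^_; _≤_)
open import Data.Product using (_×_; ∃-syntax)
open import Data.Sum using (_⊎_)
open import Relation.Binary.PropositionalEquality using (_≡_)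

data Color : Set where
  red blue : Color

-- The vertex set [N] is Fin N.  The proof argument only restricts the domain
-- to k-element sets: equality proofs in ℕ are unique, so a coloring cannot
-- depend on it.
Coloring : ℕ → ℕ → Set
Coloring k N = (S : Subset N) → ∣ S ∣ ≡ k → Color

Monochromatic : ∀ {k N} → Coloring k N → Color → Subset N → Set
Monochromatic {k} {N} χ c A =
  (S : Subset N) (∣S∣≡k : ∣ S ∣ ≡ k) → S ⊆ A → χ S ∣S∣≡k ≡ c

RamseyProperty : ℕ → ℕ → ℕ → ℕ → Set
RamseyProperty k s m N = (χ : Coloring k N) →
    (∃[ A ] (∣ A ∣ ≡ s × Monochromatic χ red A))
  ⊎ (∃[ B ] (∣ B ∣ ≡ m × Monochromatic χ blue B))

-- "r_k(s,m) = N".  Such an N is unique by antisymmetry of ≤, and it exists by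
-- Ramsey's theorem.
record IsRamseyNumber (k s m N : ℕ) : Set where
  field
    property : RamseyProperty k s m N
    least    : ∀ M → RamseyProperty k s m M → N ≤ M

-- Indexing starts at 1; the value at index 0 is a dummy.
twr : ℕ → ℕ → ℕ
twr zero          x = x
twr (suc zero)    x = x
twr (suc (suc i)) x = 2 ^ twr (suc i) x

{-# OPTIONS --safe #-}

-- Fix w = ⌊k/2⌋.  A window of w consecutive vertices is mapped to a state in a
-- digraph on four vertices so that sliding the window by one place follows an
-- arc.  A k-set X is coloured by T(u,v), where u is the state of its first w
-- elements and v that of its last w elements.  In a (k+1)-set, deleting a
-- central element, the first element and the last element gives T(u,v),
-- T(u′,v) and T(u,v′) with arcs u ⟶ u′ and v′ ⟶ v, and T is chosen so that
-- these three colours are never all equal.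
--
-- The states come from iterated line digraphs.  If each vertex x of C has sets
-- In x, Out x of vertices of D with an arc from every element of In x to every
-- element of Out x, then sending the pair (x,y) to an element of Out x ∩ In y
-- turns windows of length w + 1 over C into windows of length w over D.
-- Binary digits reduce 2^b colours to 2b in this way, which is iterated down to
-- 16 colours.  These are encoded as 3-subsets of a 6-set, and four explicit
-- tables lead from 6 colours to the four states.

module Submission where

open import Data.Bool using (true; false)
open import Data.Fin using (Fin; zero; suc; toℕ; inject≤; fromℕ<; combine; remQuot; finToFun; funToFin)
open import Data.Fin.Properties
  using (_≟_; any?; all?; inject≤-injective; toℕ-fromℕ<; remQuot-combine; funToFin-finToFin; ¬∀⟶∃¬)
open import Data.Fin.Subset using (Subset; ∣_∣; _⊆_)
open import Data.Fin.Subset.Properties using (out⊆; s⊆s; ⊆-refl)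
open import Data.List using (List; []; _∷_)
open import Data.List.Membership.DecPropositional using (_∈?_)
open import Data.List.Membership.Propositional using (_∈_)
open import Data.Nat using (ℕ; zero; suc; _+_; _∸_; _*_; _^_; _≤_; _<_; _≥_; _>_; ⌊_/2⌋; ⌈_/2⌉; z≤n; s≤s; s≤s⁻¹; s<s⁻¹; NonZero; >-nonZero)
open import Data.Nat.DivMod using (_mod_; m<n⇒m%n≡m)
import Data.Nat.Properties as ℕ
open import Data.Product using (_×_; _,_; proj₁; proj₂; ∃-syntax)
open import Data.Sum using (inj₁; inj₂)
open import Data.Vec using (Vec; []; _∷_; lookup)
open import Function using (_∘_; id)
open import Level using (0ℓ)
open import Relation.Binary using (Rel; Decidable; DecidableEquality)
open import Relation.Binary.PropositionalEquality
  using (_≡_; _≢_; refl; sym; trans; cong; cong₂; subst; _≗_; module ≡-Reasoning)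
open import Relation.Nullary using (¬_; Dec; yes; no; contradiction)
open import Relation.Nullary.Decidable using (from-yes; ¬?; _×-dec_; _→-dec_)

open import Defs

_≟ᶜ_ : DecidableEquality Color
red  ≟ᶜ red  = yes refl
red  ≟ᶜ blue = no λ ()
blue ≟ᶜ red  = no λ ()
blue ≟ᶜ blue = yes refl

-- The four states and the colour table

-- The arcs are the moves (a,b) ⟶ (b,c) between the two last letters of a
-- binary word without three equal consecutive letters, the states
-- 0, 1, 2, 3 standing for 10, 01, 00, 11.
successors : Vec (List ℕ) 4
successors = (1 ∷ 2 ∷ []) ∷ (0 ∷ 3 ∷ []) ∷ (1 ∷ []) ∷ (0 ∷ []) ∷ []

_⟶_ : Rel (Fin 4) 0ℓ
u ⟶ v = toℕ v ∈ lookup successors u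

_⟶?_ : Decidable _⟶_
u ⟶? v = _∈?_ ℕ._≟_ (toℕ v) (lookup successors u)

colorTable : Vec (Vec Color 4) 4
colorTable =
    (red  ∷ blue ∷ red  ∷ blue ∷ [])
  ∷ (blue ∷ red  ∷ blue ∷ red  ∷ [])
  ∷ (red  ∷ blue ∷ blue ∷ red  ∷ [])
  ∷ (blue ∷ red  ∷ red  ∷ blue ∷ []) ∷ []

stateColor : Fin 4 → Fin 4 → Color
stateColor u v = lookup (lookup colorTable u) v

-- The first equality forces `u` and `v` both into {0,1} or both into {2,3}; the second forces them
-- into different ones of these pairs.
stateColor-notAllEqual : ∀ u u′ v v′ → u ⟶ u′ → v′ ⟶ v →
  ¬ (stateColor u v ≡ stateColor u′ v × stateColor u v ≡ stateColor u v′)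
stateColor-notAllEqual = from-yes
  (all? λ u → all? λ u′ → all? λ v → all? λ v′ → (u ⟶? u′) →-dec (v′ ⟶? v) →-dec
    ¬? ((stateColor u v ≟ᶜ stateColor u′ v) ×-dec (stateColor u v ≟ᶜ stateColor u v′)))

-- Codings and their lifts along line digraphs

-- A window of length w is represented by an infinite sequence of which only
-- the first w entries matter, so that sliding it is composition with suc.
record Coding {C : Set} (_↝_ : Rel C 0ℓ) (w : ℕ) : Set where
  field
    state : (ℕ → C) → Fin 4
    local : ∀ {f g} → (∀ i → i < w → f i ≡ g i) → state f ≡ state g
    slide : ∀ {f} → (∀ i → i < w → f i ↝ f (suc i)) → state f ⟶ state (f ∘ suc)

open Coding

stateCoding : Coding _⟶_ 1
stateCoding .state f   = f 0
stateCoding .local f≈g = f≈g 0 ℕ.≤-refl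
stateCoding .slide f↝  = f↝ 0 ℕ.≤-refl

pullback : ∀ {C D w} {_↝_ : Rel C 0ℓ} {_↝′_ : Rel D 0ℓ} (φ : C → D) →
  (∀ {x y} → x ↝ y → φ x ↝′ φ y) → Coding _↝′_ w → Coding _↝_ w
pullback φ hom S .state f       = S .state (φ ∘ f)
pullback φ hom S .local f≈g     = S .local λ i i<w → cong φ (f≈g i i<w)
pullback φ hom S .slide f↝      = S .slide λ i i<w → hom (f↝ i i<w)

module Lift {C : Set} {n} {_↝_ : Rel (Fin n) 0ℓ} {In Out : C → Fin n → Set}
  (In? : Decidable In) (Out? : Decidable Out) (default : Fin n)
  (complete : ∀ x a b → In x a → Out x b → a ↝ b) where

  _↝ˡ_ : Rel C 0ℓ
  x ↝ˡ y = ∃[ d ] (Out x d × In y d)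

  _↝ˡ?_ : Decidable _↝ˡ_
  x ↝ˡ? y = any? λ d → Out? x d ×-dec In? y d

  arc : C → C → Fin n
  arc x y with x ↝ˡ? y
  ... | yes (d , _) = d
  -- Keeps `arc` total, since `state` accepts every sequence; `slide` only meets related pairs.
  ... | no  _       = default

  arc-spec : ∀ {x y} → x ↝ˡ y → Out x (arc x y) × In y (arc x y)
  arc-spec {x} {y} x↝y with x ↝ˡ? y
  ... | yes (_ , spec) = spec
  ... | no  x↝̸y        = contradiction x↝y x↝̸y

  -- The arc with index `i` enters `f (suc i)` and the next one leaves it, which is the situation of
  -- `complete`.
  lift : ∀ {w} → Coding _↝_ w → Coding _↝ˡ_ (suc w)
  lift S .state f     = S .state λ i → arc (f i) (f (suc i))
  lift S .local f≈g   = S .local λ i i<w →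
    cong₂ arc (f≈g i (ℕ.m<n⇒m<1+n i<w)) (f≈g (suc i) (s≤s i<w))
  lift S .slide f↝    = S .slide λ i i<w →
    complete _ _ _ (proj₂ (arc-spec (f↝ i (ℕ.m<n⇒m<1+n i<w))))
                   (proj₁ (arc-spec (f↝ (suc i) (s≤s i<w))))

-- With codes as `Out` and their complements as `In`, an arc from `x` to `y` needs an element of the
-- code of `x` outside that of `y`; an antichain provides it for all distinct `x` and `y`.
antichainLift : ∀ {C : Set} {n w} {Code : C → Fin n → Set} → Decidable Code → Fin n →
  (∀ x y → x ≢ y → ∃[ d ] (Code x d × ¬ Code y d)) →
  Coding {Fin n} _≢_ w → Coding {C} _≢_ (suc w)
antichainLift {Code = Code} Code? default incomparable S =
  pullback id (λ {x} {y} → incomparable x y) (Lift.lift (λ x d → ¬? (Code? x d)) Code? default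
    (λ { x a .a a∉x a∈x refl → a∉x a∈x }) S)

-- The bottom levels

-- Entry x of a table is the pair (In x , Out x).  The tables arise by starting
-- from ⟶ and repeatedly taking all maximal complete pairs (In , Out) over the
-- previous level as vertices; table₃ keeps 10 of 16 vertices, and the rows of
-- table₄ are pairwise joined in both directions.

module Table {m n} {_↝_ : Rel (Fin n) 0ℓ} (table : Vec (List ℕ × List ℕ) m)
  (_↝?_ : Decidable _↝_) where

  In Out : Fin m → Fin n → Set
  In  x d = toℕ d ∈ proj₁ (lookup table x)
  Out x d = toℕ d ∈ proj₂ (lookup table x)

  In? : Decidable In
  In? x d = _∈?_ ℕ._≟_ (toℕ d) (proj₁ (lookup table x))

  Out? : Decidable Out
  Out? x d = _∈?_ ℕ._≟_ (toℕ d) (proj₂ (lookup table x))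

  complete? : Dec (∀ x a b → In x a → Out x b → a ↝ b)
  complete? = all? λ x → all? λ a → all? λ b → In? x a →-dec Out? x b →-dec (a ↝? b)

table₁ : Vec (List ℕ × List ℕ) 4
table₁ =
    ((1 ∷ 3 ∷ []) , (0 ∷ []))
  ∷ ((0 ∷ 2 ∷ []) , (1 ∷ []))
  ∷ ((0 ∷ [])     , (1 ∷ 2 ∷ []))
  ∷ ((1 ∷ [])     , (0 ∷ 3 ∷ [])) ∷ []

module T₁ = Table {_↝_ = _⟶_} table₁ _⟶?_
module L₁ = Lift T₁.In? T₁.Out? zero (from-yes T₁.complete?)

table₂ : Vec (List ℕ × List ℕ) 7
table₂ =
    ((1 ∷ 2 ∷ 3 ∷ []) , (0 ∷ []))
  ∷ ((0 ∷ 2 ∷ 3 ∷ []) , (1 ∷ []))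
  ∷ ((2 ∷ 3 ∷ [])     , (0 ∷ 1 ∷ []))
  ∷ ((0 ∷ 3 ∷ [])     , (1 ∷ 2 ∷ []))
  ∷ ((3 ∷ [])         , (0 ∷ 1 ∷ 2 ∷ []))
  ∷ ((1 ∷ 2 ∷ [])     , (0 ∷ 3 ∷ []))
  ∷ ((2 ∷ [])         , (0 ∷ 1 ∷ 3 ∷ [])) ∷ []

module T₂ = Table {_↝_ = L₁._↝ˡ_} table₂ L₁._↝ˡ?_
module L₂ = Lift T₂.In? T₂.Out? zero (from-yes T₂.complete?)

table₃ : Vec (List ℕ × List ℕ) 10
table₃ =
    ((3 ∷ 4 ∷ 5 ∷ 6 ∷ [])     , (0 ∷ 1 ∷ 2 ∷ []))
  ∷ ((0 ∷ 2 ∷ 4 ∷ 5 ∷ 6 ∷ []) , (1 ∷ 3 ∷ []))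
  ∷ ((2 ∷ 4 ∷ 5 ∷ 6 ∷ [])     , (0 ∷ 1 ∷ 3 ∷ []))
  ∷ ((4 ∷ 5 ∷ 6 ∷ [])         , (0 ∷ 1 ∷ 2 ∷ 3 ∷ []))
  ∷ ((5 ∷ 6 ∷ [])             , (0 ∷ 1 ∷ 2 ∷ 3 ∷ 4 ∷ []))
  ∷ ((1 ∷ 2 ∷ 3 ∷ 4 ∷ 6 ∷ []) , (0 ∷ 5 ∷ []))
  ∷ ((2 ∷ 3 ∷ 4 ∷ 6 ∷ [])     , (0 ∷ 1 ∷ 5 ∷ []))
  ∷ ((3 ∷ 4 ∷ [])             , (0 ∷ 1 ∷ 2 ∷ 5 ∷ 6 ∷ []))
  ∷ ((3 ∷ 4 ∷ 6 ∷ [])         , (0 ∷ 1 ∷ 2 ∷ 5 ∷ []))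
  ∷ ((2 ∷ 4 ∷ 6 ∷ [])         , (0 ∷ 1 ∷ 3 ∷ 5 ∷ [])) ∷ []

module T₃ = Table {_↝_ = L₂._↝ˡ_} table₃ L₂._↝ˡ?_
module L₃ = Lift T₃.In? T₃.Out? zero (from-yes T₃.complete?)

table₄ : Vec (List ℕ × List ℕ) 6
table₄ =
    ((5 ∷ 6 ∷ 7 ∷ 8 ∷ 9 ∷ []) , (0 ∷ 1 ∷ 2 ∷ 3 ∷ 4 ∷ []))
  ∷ ((1 ∷ 2 ∷ 3 ∷ 4 ∷ 9 ∷ []) , (0 ∷ 5 ∷ 6 ∷ 7 ∷ 8 ∷ []))
  ∷ ((2 ∷ 3 ∷ 4 ∷ 7 ∷ 9 ∷ []) , (0 ∷ 1 ∷ 5 ∷ 6 ∷ 8 ∷ []))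
  ∷ ((0 ∷ 3 ∷ 4 ∷ 7 ∷ 8 ∷ []) , (1 ∷ 2 ∷ 5 ∷ 6 ∷ 9 ∷ []))
  ∷ ((3 ∷ 4 ∷ 7 ∷ 8 ∷ 9 ∷ []) , (0 ∷ 1 ∷ 2 ∷ 5 ∷ 6 ∷ []))
  ∷ ((4 ∷ 6 ∷ 7 ∷ 8 ∷ 9 ∷ []) , (0 ∷ 1 ∷ 2 ∷ 3 ∷ 5 ∷ [])) ∷ []

module T₄ = Table {_↝_ = L₃._↝ˡ_} table₄ L₃._↝ˡ?_
module L₄ = Lift T₄.In? T₄.Out? zero (from-yes T₄.complete?)

coding₆ : Coding {Fin 6} _≢_ 5
coding₆ = pullback id (λ {x} {y} → distinct⇒↝ x y)
  (L₄.lift (L₃.lift (L₂.lift (L₁.lift stateCoding))))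
  where
  distinct⇒↝ : ∀ x y → x ≢ y → x L₄.↝ˡ y
  distinct⇒↝ = from-yes (all? λ x → all? λ y → ¬? (x ≟ y) →-dec (x L₄.↝ˡ? y))

threeSubsets : Vec (List ℕ) 20
threeSubsets =
    (0 ∷ 1 ∷ 2 ∷ []) ∷ (0 ∷ 1 ∷ 3 ∷ []) ∷ (0 ∷ 1 ∷ 4 ∷ []) ∷ (0 ∷ 1 ∷ 5 ∷ [])
  ∷ (0 ∷ 2 ∷ 3 ∷ []) ∷ (0 ∷ 2 ∷ 4 ∷ []) ∷ (0 ∷ 2 ∷ 5 ∷ []) ∷ (0 ∷ 3 ∷ 4 ∷ [])
  ∷ (0 ∷ 3 ∷ 5 ∷ []) ∷ (0 ∷ 4 ∷ 5 ∷ []) ∷ (1 ∷ 2 ∷ 3 ∷ []) ∷ (1 ∷ 2 ∷ 4 ∷ [])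
  ∷ (1 ∷ 2 ∷ 5 ∷ []) ∷ (1 ∷ 3 ∷ 4 ∷ []) ∷ (1 ∷ 3 ∷ 5 ∷ []) ∷ (1 ∷ 4 ∷ 5 ∷ [])
  ∷ (2 ∷ 3 ∷ 4 ∷ []) ∷ (2 ∷ 3 ∷ 5 ∷ []) ∷ (2 ∷ 4 ∷ 5 ∷ []) ∷ (3 ∷ 4 ∷ 5 ∷ []) ∷ []

-- Distinct sets of equal size are incomparable.
coding₂₀ : Coding {Fin 20} _≢_ 6
coding₂₀ = antichainLift code? zero
  (from-yes (all? λ x → all? λ y → ¬? (x ≟ y) →-dec any? λ d → code? x d ×-dec ¬? (code? y d)))
  coding₆
  where
  code? : Decidable (λ x (d : Fin 6) → toℕ d ∈ lookup threeSubsets x)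
  code? x d = _∈?_ ℕ._≟_ (toℕ d) (lookup threeSubsets x)

-- From binary towers down to 20 colours

-- A word is coded by its graph, the `b` pairs (position, digit); words that differ at some position
-- have incomparable graphs.
binaryLift : ∀ b {w} → Fin (b * 2) → Coding {Fin (b * 2)} _≢_ w → Coding {Fin (2 ^ b)} _≢_ (suc w)
binaryLift b default = antichainLift (λ x d → digit x (position d) ≟ value d) default incomparable
  where
  digit : Fin (2 ^ b) → Fin b → Fin 2
  digit = finToFun

  position : Fin (b * 2) → Fin b
  position d = proj₁ (remQuot 2 d)

  value : Fin (b * 2) → Fin 2
  value d = proj₂ (remQuot {b} 2 d)

  digit-injective : ∀ {x y} → (∀ i → digit x i ≡ digit y i) → x ≡ y
  digit-injective {x} {y} eq = begin
    x                          ≡⟨ funToFin-finToFin {b} x ⟨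
    funToFin (digit x)         ≡⟨ funToFin-cong eq ⟩
    funToFin (digit y)         ≡⟨ funToFin-finToFin {b} y ⟩
    y                          ∎
    where
    open ≡-Reasoning
    funToFin-cong : ∀ {m n} {f g : Fin m → Fin n} → f ≗ g → funToFin f ≡ funToFin g
    funToFin-cong {zero}  f≗g = refl
    funToFin-cong {suc m} f≗g = cong₂ combine (f≗g zero) (funToFin-cong (f≗g ∘ suc))

  incomparable : ∀ x y → x ≢ y →
    ∃[ d ] (digit x (position d) ≡ value d × digit y (position d) ≢ value d)
  incomparable x y x≢y
    with i , xᵢ≢yᵢ ← ¬∀⟶∃¬ b _ (λ i → digit x i ≟ digit y i) (x≢y ∘ digit-injective)
    = combine i (digit x i) , digits (remQuot-combine i (digit x i))
    where
    digits : ∀ {r} → r ≡ (i , digit x i) →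
      digit x (proj₁ r) ≡ proj₂ r × digit y (proj₁ r) ≢ proj₂ r
    digits refl = refl , xᵢ≢yᵢ ∘ sym

pullback-≤ : ∀ {m n w} → m ≤ n → Coding {Fin n} _≢_ w → Coding {Fin m} _≢_ w
pullback-≤ m≤n = pullback (λ x → inject≤ x m≤n) (λ x≢y → x≢y ∘ inject≤-injective m≤n m≤n _ _)

2≤twr : ∀ i → 2 ≤ twr (suc i) 2
2≤twr zero    = ℕ.≤-refl
2≤twr (suc i) = ℕ.^-monoʳ-≤ 2 (ℕ.<⇒≤ (2≤twr i))

n*2*2≡4*n : ∀ n → n * 2 * 2 ≡ 4 * n
n*2*2≡4*n n = trans (ℕ.*-assoc n 2 2) (ℕ.*-comm n 4)

-- The factor 4 reproduces itself: `2 ^ (2 + t)` is `4 * 2 ^ t`, and `2 + t` digits need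
-- `(2 + t) * 2` colours, at most `4 * t` since `2 ≤ t`.
towerCoding : ∀ i → Coding {Fin (4 * twr (2 + i) 2)} _≢_ (6 + i)
towerCoding zero    = pullback-≤ (ℕ.m≤m+n 16 4) coding₂₀
towerCoding (suc i) = pullback-≤ (ℕ.≤-reflexive (sym (ℕ.^-distribˡ-+-* 2 2 t)))
  (binaryLift (2 + t) zero (pullback-≤ [2+t]*2≤4*t (towerCoding i)))
  where
  t = twr (2 + i) 2

  [2+t]*2≤4*t : (2 + t) * 2 ≤ 4 * t
  [2+t]*2≤4*t = begin
    (2 + t) * 2  ≤⟨ ℕ.*-monoˡ-≤ 2 (ℕ.+-monoˡ-≤ t (2≤twr (suc i))) ⟩
    (t + t) * 2  ≡⟨ cong (λ s → (t + s) * 2) (ℕ.+-identityʳ t) ⟨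
    2 * t * 2    ≡⟨ cong (_* 2) (ℕ.*-comm 2 t) ⟩
    t * 2 * 2    ≡⟨ n*2*2≡4*n t ⟩
    4 * t        ∎
    where open ℕ.≤-Reasoning

-- One last step turns the factor 4 into the square: `t * 2` digits use all `4 * t` colours and give
-- `(2 ^ t) ^ 2`.
squareCoding : ∀ i → Coding {Fin (twr (3 + i) 2 ^ 2)} _≢_ (7 + i)
squareCoding i = pullback-≤ (ℕ.≤-reflexive (ℕ.^-*-assoc 2 t 2))
  (binaryLift (t * 2) (fromℕ< 0<t*2*2) (pullback-≤ (ℕ.≤-reflexive (n*2*2≡4*n t)) (towerCoding i)))
  where
  t = twr (2 + i) 2

  0<t*2*2 : 0 < t * 2 * 2
  0<t*2*2 = ℕ.*-mono-≤ (ℕ.*-mono-≤ (ℕ.<⇒≤ (2≤twr (suc i))) (s≤s z≤n)) (s≤s z≤n)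

-- Reduction modulo `q` fixes every number below `N`, so distinct vertices stay distinct.
boundedCoding : ∀ {N q w} → 0 < q → N ≤ q → Coding {Fin q} _≢_ w →
  Coding {ℕ} (λ x y → x < N × y < N × x ≢ y) w
boundedCoding {N} {q} 0<q N≤q = pullback (_mod q) λ {x} {y} (x<N , y<N , x≢y) eq →
  x≢y (trans (sym (toℕ-mod x<N)) (trans (cong toℕ eq) (toℕ-mod y<N)))
  where
  instance
    q≢0 : NonZero q
    q≢0 = >-nonZero 0<q

  toℕ-mod : ∀ {x} → x < N → toℕ (x mod q) ≡ x
  toℕ-mod x<N = trans (toℕ-fromℕ< _) (m<n⇒m%n≡m (ℕ.<-≤-trans x<N N≤q))

-- Elements of a subset in increasing order

-- Junk value: for i ≥ ∣ S ∣ the result is n.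
nth : ∀ {n} → Subset n → ℕ → ℕ
nth []          i       = 0
nth (true  ∷ S) zero    = 0
nth (true  ∷ S) (suc i) = suc (nth S i)
nth (false ∷ S) i       = suc (nth S i)

nth-< : ∀ {n} (S : Subset n) {i} → i < ∣ S ∣ → nth S i < n
nth-< (true  ∷ S) {zero}  _     = s≤s z≤n
nth-< (true  ∷ S) {suc i} i<∣S∣ = s≤s (nth-< S (s<s⁻¹ i<∣S∣))
nth-< (false ∷ S)         i<∣S∣ = s≤s (nth-< S i<∣S∣)

nth-increasing : ∀ {n} (S : Subset n) {i} → suc i < ∣ S ∣ → nth S i < nth S (suc i)
nth-increasing (true  ∷ S) {zero}  _     = s≤s z≤n
nth-increasing (true  ∷ S) {suc i} i<∣S∣ = s≤s (nth-increasing S (s<s⁻¹ i<∣S∣))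
nth-increasing (false ∷ S)         i<∣S∣ = s≤s (nth-increasing S i<∣S∣)

removeNth : ∀ {n} → ℕ → Subset n → Subset n
removeNth i       []          = []
removeNth zero    (true  ∷ S) = false ∷ S
removeNth (suc i) (true  ∷ S) = true ∷ removeNth i S
removeNth i       (false ∷ S) = false ∷ removeNth i S

removeNth-⊆ : ∀ {n} i (S : Subset n) → removeNth i S ⊆ S
removeNth-⊆ i       []          = id
removeNth-⊆ zero    (true  ∷ S) = out⊆ ⊆-refl
removeNth-⊆ (suc i) (true  ∷ S) = s⊆s (removeNth-⊆ i S)
removeNth-⊆ zero    (false ∷ S) = s⊆s (removeNth-⊆ zero S)
removeNth-⊆ (suc i) (false ∷ S) = s⊆s (removeNth-⊆ (suc i) S)

∣removeNth∣ : ∀ {n i} (S : Subset n) → i < ∣ S ∣ → suc ∣ removeNth i S ∣ ≡ ∣ S ∣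
∣removeNth∣ {i = zero}  (true  ∷ S) _     = refl
∣removeNth∣ {i = suc i} (true  ∷ S) i<∣S∣ = cong suc (∣removeNth∣ S (s<s⁻¹ i<∣S∣))
∣removeNth∣ {i = zero}  (false ∷ S) i<∣S∣ = ∣removeNth∣ S i<∣S∣
∣removeNth∣ {i = suc i} (false ∷ S) i<∣S∣ = ∣removeNth∣ S i<∣S∣

nth-removeNth-< : ∀ {n p i} (S : Subset n) → i < p → nth (removeNth p S) i ≡ nth S i
nth-removeNth-< {p = suc p}             []          i<p = refl
nth-removeNth-< {p = suc p} {i = zero}  (true  ∷ S) i<p = refl
nth-removeNth-< {p = suc p} {i = suc i} (true  ∷ S) i<p = cong suc (nth-removeNth-< S (s<s⁻¹ i<p))
nth-removeNth-< {p = suc p}             (false ∷ S) i<p = cong suc (nth-removeNth-< S i<p)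

nth-removeNth-≥ : ∀ {n p i} (S : Subset n) → p ≤ i → nth (removeNth p S) i ≡ nth S (suc i)
nth-removeNth-≥ {p = zero}              []          p≤i = refl
nth-removeNth-≥ {p = suc p}             []          p≤i = refl
nth-removeNth-≥ {p = zero}              (true  ∷ S) p≤i = refl
nth-removeNth-≥ {p = suc p} {i = suc i} (true  ∷ S) p≤i = cong suc (nth-removeNth-≥ S (s≤s⁻¹ p≤i))
nth-removeNth-≥ {p = zero}              (false ∷ S) p≤i = cong suc (nth-removeNth-≥ S p≤i)
nth-removeNth-≥ {p = suc p}             (false ∷ S) p≤i = cong suc (nth-removeNth-≥ S p≤i)

-- The coloring

module WindowColoring {k N w} (2w≤k : w + w ≤ k)
  (S : Coding {ℕ} (λ x y → x < N × y < N × x ≢ y) w) where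

  d : ℕ
  d = k ∸ w

  w≤k : w ≤ k
  w≤k = ℕ.≤-trans (ℕ.m≤m+n w w) 2w≤k

  w≤d : w ≤ d
  w≤d = subst (_≤ d) (ℕ.m+n∸n≡m w w) (ℕ.∸-monoˡ-≤ w 2w≤k)

  w+d≡k : w + d ≡ k
  w+d≡k = ℕ.m+[n∸m]≡n w≤k

  coloring : Coloring k N
  coloring X _ = stateColor (S .state (nth X)) (S .state (λ i → nth X (i + d)))

  not-monochromatic : ∀ c A → ∣ A ∣ ≡ k + 1 → ¬ Monochromatic coloring c A
  not-monochromatic c A ∣A∣≡k+1 mono = stateColor-notAllEqual u u′ v v′ u⟶u′ v′⟶v
    (trans uv≡c (sym u′v≡c) , trans uv≡c (sym uv′≡c))
    where
    a : ℕ → ℕ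
    a = nth A

    u u′ v v′ : Fin 4
    u  = S .state a
    u′ = S .state (a ∘ suc)
    v′ = S .state (λ i → a (i + d))
    v  = S .state (λ i → a (suc i + d))

    ∣A∣≡1+k : ∣ A ∣ ≡ suc k
    ∣A∣≡1+k = trans ∣A∣≡k+1 (ℕ.+-comm k 1)

    i+d<k : ∀ {i} → i < w → i + d < k
    i+d<k {i} i<w = subst (i + d <_) w+d≡k (ℕ.+-monoˡ-< d i<w)

    color-at : ∀ {f g} p → p ≤ k →
      (∀ i → i < w → nth (removeNth p A) i ≡ f i) →
      (∀ i → i < w → nth (removeNth p A) (i + d) ≡ g i) →
      stateColor (S .state f) (S .state g) ≡ c
    color-at p p≤k f≈ g≈ = trans (sym (cong₂ stateColor (S .local f≈) (S .local g≈)))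
      (mono (removeNth p A) (ℕ.suc-injective (trans (∣removeNth∣ A p<∣A∣) ∣A∣≡1+k)) (removeNth-⊆ p A))
      where
      p<∣A∣ : p < ∣ A ∣
      p<∣A∣ = subst (p <_) (sym ∣A∣≡1+k) (s≤s p≤k)

    uv≡c : stateColor u v ≡ c
    -- Index `w` lies just past the first window and, as `w ≤ d`, not past the start of the last
    -- one, so only the last window shifts.
    uv≡c = color-at w w≤k (λ i i<w → nth-removeNth-< A i<w)
      (λ i _ → nth-removeNth-≥ A (ℕ.≤-trans w≤d (ℕ.m≤n+m d i)))

    u′v≡c : stateColor u′ v ≡ c
    u′v≡c = color-at 0 z≤n (λ i _ → nth-removeNth-≥ A z≤n) (λ i _ → nth-removeNth-≥ A z≤n)

    uv′≡c : stateColor u v′ ≡ c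
    uv′≡c = color-at k ℕ.≤-refl (λ i i<w → nth-removeNth-< A (ℕ.<-≤-trans i<w w≤k))
      (λ i i<w → nth-removeNth-< A (i+d<k i<w))

    a-step : ∀ {i} → i < k → a i < N × a (suc i) < N × a i ≢ a (suc i)
    a-step {i} i<k = nth-< A (ℕ.<-trans (ℕ.n<1+n i) 1+i<∣A∣) , nth-< A 1+i<∣A∣ ,
      ℕ.<⇒≢ (nth-increasing A 1+i<∣A∣)
      where
      1+i<∣A∣ : suc i < ∣ A ∣
      1+i<∣A∣ = subst (suc i <_) (sym ∣A∣≡1+k) (s≤s i<k)

    u⟶u′ : u ⟶ u′
    u⟶u′ = S .slide λ i i<w → a-step (ℕ.<-≤-trans i<w w≤k)

    v′⟶v : v′ ⟶ v
    v′⟶v = S .slide λ i i<w → a-step (i+d<k i<w)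

  ¬RamseyProperty : ¬ RamseyProperty k (k + 1) (k + 1) N
  ¬RamseyProperty ramsey with ramsey coloring
  ... | inj₁ (A , ∣A∣≡k+1 , mono) = not-monochromatic red A ∣A∣≡k+1 mono
  ... | inj₂ (B , ∣B∣≡k+1 , mono) = not-monochromatic blue B ∣B∣≡k+1 mono

-- Windows of half length and the lower bound

⌊n/2⌋+⌊n/2⌋≤n : ∀ n → ⌊ n /2⌋ + ⌊ n /2⌋ ≤ n
⌊n/2⌋+⌊n/2⌋≤n n = begin
  ⌊ n /2⌋ + ⌊ n /2⌋      ≤⟨ ℕ.+-monoʳ-≤ ⌊ n /2⌋ (ℕ.⌊n/2⌋≤⌈n/2⌉ n) ⟩
  ⌊ n /2⌋ + ⌈ n /2⌉    ≡⟨ ℕ.⌊n/2⌋+⌈n/2⌉≡n n ⟩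
  n                      ∎
  where open ℕ.≤-Reasoning

mainTheorem3 : ∀ (k : ℕ) → k ≥ 14 →
    ∀ (r : ℕ) → IsRamseyNumber k (k + 1) (k + 1) r →
    r > (twr (⌊ k /2⌋ ∸ 4) 2) ^ 2
mainTheorem3 k k≥14 r isRamsey = ℕ.≰⇒> λ r≤T² → WindowColoring.¬RamseyProperty
  (⌊n/2⌋+⌊n/2⌋≤n k)
  (boundedCoding 0<T² r≤T² coding)
  (IsRamseyNumber.property isRamsey)
  where
  -- `k ≥ 14` gives windows of length at least 7, the shortest that `squareCoding` treats.
  j : ℕ
  j = ⌊ k /2⌋ ∸ 7

  7+j≡⌊k/2⌋ : 7 + j ≡ ⌊ k /2⌋
  7+j≡⌊k/2⌋ = ℕ.m+[n∸m]≡n (ℕ.⌊n/2⌋-mono k≥14)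

  coding : Coding {Fin (twr (⌊ k /2⌋ ∸ 4) 2 ^ 2)} _≢_ ⌊ k /2⌋
  -- `7 + j ∸ 4` computes to `3 + j`, the tower index in `squareCoding j`.
  coding = subst (λ w → Coding {Fin (twr (w ∸ 4) 2 ^ 2)} _≢_ w) 7+j≡⌊k/2⌋ (squareCoding j)

  0<T² : 0 < twr (⌊ k /2⌋ ∸ 4) 2 ^ 2
  0<T² = subst (λ w → 0 < twr (w ∸ 4) 2 ^ 2) 7+j≡⌊k/2⌋ (ℕ.^-monoˡ-≤ 2 (ℕ.<⇒≤ (2≤twr (2 + j))))
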